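{- Let $G$ be a finite simple graph of order $n$ with $m$ edges and minimum degree $\delta$, and let $k\geq 0$ and $t\geq 1$ be integers. Then $$\mathrm{sp}(G,k)\ \geq\ \frac{2\left( n\left(\delta+t(k+1)\right)-2m+\sum_{v\in V(G)}\varepsilon_{t}(\deg(v))\right)}{(k+1)\,t(t+1)} .$$
   Context: For a graph $G$ and $B\subseteq V(G)$ the spread is $\mathrm{sp}(B)=\max_{u\in B}\deg_G(u)-\min_{v\in B}\deg_G(v)$, and $\mathrm{sp}(G,k)$ is the largest cardinality of a set $B\subseteq V(G)$ with $\mathrm{sp}(B)\leq k$. Put $h=k+1$. For $i\geq 0$ let $I_i=\{\delta+ih,\delta+ih+1,\ldots,\delta+ih+k\}$, and let $\mu(x,i)=1$ if $x\in I_i$ and $\mu(x,i)=0$ otherwise. For integers $t\geq 1$ and $x\geq\delta$ put $$u_t(x)=\sum_{i=0}^{t-1}(t-i)\,\mu(x,i),\qquad \varepsilon_t(x)=h\,u_t(x)-(\delta+th-x).$$ -}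

module Defs where

open import Data.Bool.Base using (if_then_else_)
open import Data.Fin.Base using (Fin; toℕ)
open import Data.Fin.Properties using (_<?_)
open import Data.Fin.Subset using (Subset; inside; outside; ⊤; ∣_∣)
open import Data.Fin.Subset.Properties using (_∈?_)
open import Data.Integer.Base as ℤ using (ℤ; +_)
open import Data.List.Base using (List; []; _∷_; _++_; map; filter; length; allFin; cartesianProduct)
open import Data.List.Extrema.Nat using (max; min)
open import Data.Nat.Base using (ℕ; zero; suc; _+_; _*_; _∸_; _≤_; NonZero)
import Data.Nat.Properties as ℕ
open import Data.Product.Base using (_×_; _,_)
open import Data.Vec.Base as Vec using (tabulate)
open import Level using (0ℓ)
open import Relation.Binary.Core using (Rel)
open import Relation.Binary.Definitions using (Decidable; Symmetric)
open import Relation.Nullary using (¬_; Dec; does; _×-dec_)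
open import Relation.Unary using (Pred)

open import Algebra.Properties.CommutativeMonoid.Sum ℕ.+-0-commutativeMonoid
  using (sum-syntax)

record Graph (n : ℕ) : Set₁ where
  field
    Adj     : Rel (Fin n) 0ℓ
    adj?    : Decidable Adj
    symm    : Symmetric Adj
    noLoops : ∀ v → ¬ Adj v v

subsets : ∀ n → List (Subset n)
subsets zero    = Vec.[] ∷ []
subsets (suc n) = map (inside Vec.∷_) (subsets n) ++ map (outside Vec.∷_) (subsets n)

module _ {n : ℕ} (G : Graph n) where
  open Graph G

  neighbours : Fin n → Subset n
  neighbours v = tabulate (λ w → does (adj? v w))

  deg : Fin n → ℕ
  deg v = ∣ neighbours v ∣

  -- Each edge {v , w} is counted once, as the pair with v < w.
  numEdges : ℕ
  numEdges = length (filter (λ (v , w) → (v <? w) ×-dec adj? v w)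
                            (cartesianProduct (allFin n) (allFin n)))

  degreesIn : Subset n → List ℕ
  degreesIn B = map deg (filter (_∈? B) (allFin n))

  -- The first arguments of `max` and `min` are the values on the empty list.
  -- Every degree lies between 0 and n, so for nonempty B they play no role.
  maxDegreeIn minDegreeIn : Subset n → ℕ
  maxDegreeIn B = max 0 (degreesIn B)
  minDegreeIn B = min n (degreesIn B)

  minDegree : ℕ
  minDegree = minDegreeIn ⊤

  spread : Subset n → ℕ
  spread B = maxDegreeIn B ∸ minDegreeIn B

  -- The empty set gets spread 0, but having cardinality 0 it never affects
  -- the maximum.
  sp : ℕ → ℕ
  sp k = max 0 (map ∣_∣ (filter (λ B → spread B ℕ.≤? k) (subsets n)))

-- Throughout, h = k + 1 is written `suc k`.
module _ (δ k : ℕ) where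

  I : ℕ → Pred ℕ 0ℓ
  I i x = δ + i * suc k ≤ x × x ≤ δ + i * suc k + k

  I? : ∀ i x → Dec (I i x)
  I? i x = (δ + i * suc k ℕ.≤? x) ×-dec (x ℕ.≤? δ + i * suc k + k)

  μ : ℕ → ℕ → ℕ
  μ x i = if does (I? i x) then 1 else 0

  u : ℕ → ℕ → ℕ
  u t x = ∑[ i < t ] ((t ∸ toℕ i) * μ x (toℕ i))

  ε : ℕ → ℕ → ℤ
  ε t x = + (suc k * u t x) ℤ.- (+ (δ + t * suc k) ℤ.- + x)

denominator≢0 : ∀ k t .{{_ : NonZero t}} → NonZero (suc k * t * suc t)
denominator≢0 k t = ℕ.m*n≢0 (suc k * t) (suc t) {{ℕ.m*n≢0 (suc k) t}}

{-# OPTIONS --safe #-}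
-- Summing the definition of ε_t over all vertices, the terms δ + th cancel and the degrees
-- add up to 2m, so the numerator is 2h ∑_v u_t(deg v).  Exchanging the order of summation,
-- ∑_v u_t(deg v) = ∑_{i<t} (t - i) |B_i| with B_i the set of vertices of degree in I_i.
-- Each B_i has spread at most k, so this is at most sp(G,k) · t(t+1)/2.
module Submission where

open import Defs
open import Data.Nat.Base as ℕ using (ℕ; suc; NonZero)
open import Data.Integer.Base using (+_; _+_; _-_; _*_)
open import Data.Integer.Properties using (+-0-commutativeMonoid)
open import Data.Rational.Base using (_/_; _≥_)
open import Algebra.Properties.CommutativeMonoid.Sum +-0-commutativeMonoid using (sum-syntax)

open import Data.Bool.Base using (Bool; true; false; if_then_else_)
open import Data.Fin.Base as Fin using (Fin; zero; suc; toℕ)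
open import Data.Fin.Properties using (<-cmp; _<?_)
open import Data.Fin.Subset using (Subset; ∣_∣; _∈_; inside; outside)
open import Data.Fin.Subset.Properties using (_∈?_; ∣p∣≤n)
open import Data.Integer.Base as ℤ using (ℤ; +≤+)
import Data.Integer.Properties as ℤ
import Data.Integer.Tactic.RingSolver as ℤ-Solver
open import Data.List.Base as List
  using ([]; _∷_; length; filter; allFin; cartesianProduct)
open import Data.List.Extrema.Nat using (max; min; max≤v⁺; v≤min⁺; v≤max⁺)
open import Data.List.Membership.Propositional using () renaming (_∈_ to _∈ₗ_)
open import Data.List.Membership.Propositional.Properties
  using (∈-++⁺ˡ; ∈-++⁺ʳ; ∈-map⁺; ∈-filter⁺)
open import Data.List.Properties using (filter-++; length-++; map-tabulate)
open import Data.List.Relation.Unary.All as All using (All; []; _∷_)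
open import Data.List.Relation.Unary.All.Properties as All using (all-filter)
open import Data.List.Relation.Unary.Any as Any using (here)
import Data.Nat.Properties as ℕ
import Data.Nat.Tactic.RingSolver as ℕ-Solver
open import Data.Product.Base using (_×_; _,_; proj₁; proj₂)
import Data.Rational.Properties as ℚ
import Data.Rational.Unnormalised.Base as ℚᵘ
import Data.Rational.Unnormalised.Properties as ℚᵘ
open import Data.Sum.Base using (inj₂)
open import Data.Vec.Base as Vec using (tabulate)
open import Data.Vec.Properties using ([]=⇒lookup; lookup∘tabulate)
open import Function.Base using (_∘_; id)
open import Function.Bundles using (mk⇔)
open import Level using (0ℓ)
open import Relation.Binary.Definitions using (tri<; tri≈; tri>)
open import Relation.Binary.PropositionalEquality
open import Relation.Nullary using (does; yes; no; _×-dec_)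
open import Relation.Nullary.Decidable using (dec-true; dec-false; does-⇔)
open import Relation.Unary using (Pred; Decidable)

open import Algebra.Properties.CommutativeMonoid.Sum ℕ.+-0-commutativeMonoid
  using (∑-comm; ∑-distrib-+; sum-cong-≗) renaming (sum to sumℕ)
open import Algebra.Properties.Semiring.Sum ℕ.+-*-semiring
  using (*-distribˡ-sum; *-distribʳ-sum)

-- Cardinalities and list lengths as sums of 0/1 indicators.

sum-mono-≤ : ∀ {n} {f g : Fin n → ℕ} → (∀ i → f i ℕ.≤ g i) → sumℕ f ℕ.≤ sumℕ g
sum-mono-≤ {0}     f≤g = ℕ.z≤n
sum-mono-≤ {suc n} f≤g = ℕ.+-mono-≤ (f≤g zero) (sum-mono-≤ (f≤g ∘ suc))

∣tabulate∣ : ∀ {n} (p : Fin n → Bool) → ∣ tabulate p ∣ ≡ sumℕ (λ i → if p i then 1 else 0)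
∣tabulate∣ {0}     p = refl
∣tabulate∣ {suc n} p with p zero
... | true  = cong suc (∣tabulate∣ (p ∘ suc))
... | false = ∣tabulate∣ (p ∘ suc)

∈-tabulate⁻ : ∀ {n} {P : Pred (Fin n) 0ℓ} (P? : Decidable P) {i} →
              i ∈ tabulate (does ∘ P?) → P i
-- The second term has type `does (P? i) ≡ true`. Abstracting `P? i` in it turns the `no` case into
-- `false ≡ true`.
∈-tabulate⁻ P? {i} i∈ with P? i | trans (sym (lookup∘tabulate (does ∘ P?) i)) ([]=⇒lookup i∈)
... | yes p | _ = p
... | no  _ | ()

length-filter-tabulate :
  ∀ {A : Set} {P : Pred A 0ℓ} (P? : Decidable P) {n} (f : Fin n → A) →
  length (filter P? (List.tabulate f)) ≡ sumℕ (λ i → if does (P? (f i)) then 1 else 0)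
length-filter-tabulate P? {0}     f = refl
length-filter-tabulate P? {suc n} f with does (P? (f zero))
... | true  = cong suc (length-filter-tabulate P? (f ∘ suc))
... | false = length-filter-tabulate P? (f ∘ suc)

length-filter-cartesianProduct :
  ∀ {A B : Set} {P : Pred (A × B) 0ℓ} (P? : Decidable P) {m n} (f : Fin m → A) (g : Fin n → B) →
  length (filter P? (cartesianProduct (List.tabulate f) (List.tabulate g))) ≡
  sumℕ (λ i → sumℕ (λ j → if does (P? (f i , g j)) then 1 else 0))
length-filter-cartesianProduct P? {0}     f g = refl
length-filter-cartesianProduct P? {suc m} f g = begin
  length (filter P? (row List.++ rest))
    ≡⟨ cong length (filter-++ P? row rest) ⟩
  length (filter P? row List.++ filter P? rest)
    ≡⟨ length-++ (filter P? row) ⟩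
  length (filter P? row) ℕ.+ length (filter P? rest)
    ≡⟨ cong₂ ℕ._+_
         (trans (cong (length ∘ filter P?) (map-tabulate g (f zero ,_)))
                (length-filter-tabulate P? (λ j → f zero , g j)))
         (length-filter-cartesianProduct P? (f ∘ suc) g) ⟩
  _ ∎
  where
  open ≡-Reasoning
  row  = List.map (f zero ,_) (List.tabulate g)
  rest = cartesianProduct (List.tabulate (f ∘ suc)) (List.tabulate g)

-- The degree sum.

module _ {n : ℕ} (G : Graph n) where
  open Graph G

  private
    edge? : Decidable (λ ((v , w) : Fin n × Fin n) → v Fin.< w × Adj v w)
    edge? (v , w) = (v <? w) ×-dec adj? v w

    adj edge : Fin n → Fin n → ℕ
    adj  v w = if does (adj? v w) then 1 else 0
    edge v w = if does (edge? (v , w)) then 1 else 0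

    -- By trichotomy at most one of the two orientations is increasing, and symmetry of `Adj` makes
    -- it count the same adjacency. On the diagonal everything vanishes, as there are no loops.
    adj≡edge+edge : ∀ v w → adj v w ≡ edge v w ℕ.+ edge w v
    adj≡edge+edge v w with <-cmp v w
    ... | tri< v<w _ w≮v rewrite dec-true (v <? w) v<w | dec-false (w <? v) w≮v =
      sym (ℕ.+-identityʳ _)
    ... | tri> v≮w _ w<v rewrite dec-false (v <? w) v≮w | dec-true (w <? v) w<v =
      cong (if_then 1 else 0) (does-⇔ (mk⇔ symm symm) (adj? v w) (adj? w v))
    ... | tri≈ v≮w refl _ rewrite dec-false (v <? v) v≮w | dec-false (adj? v v) (noLoops v) = refl

  handshake : sumℕ (deg G) ≡ 2 ℕ.* numEdges G
  handshake = begin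
    sumℕ (deg G)
      ≡⟨ sum-cong-≗ (λ v → trans (∣tabulate∣ (λ w → does (adj? v w)))
                                 (trans (sum-cong-≗ (adj≡edge+edge v))
                                        (∑-distrib-+ (edge v) (λ w → edge w v)))) ⟩
    sumℕ (λ v → sumℕ (edge v) ℕ.+ sumℕ (λ w → edge w v))
      ≡⟨ ∑-distrib-+ (λ v → sumℕ (edge v)) (λ v → sumℕ (λ w → edge w v)) ⟩
    E ℕ.+ sumℕ (λ v → sumℕ (λ w → edge w v))
      -- Exchanging the order of summation turns the sum over reversed pairs into `E` again. The
      -- added zero is there because `2 ℕ.* E` unfolds to `E ℕ.+ (E ℕ.+ 0)`.
      ≡⟨ cong₂ ℕ._+_ refl (trans (∑-comm (λ v w → edge w v)) (sym (ℕ.+-identityʳ E))) ⟩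
    2 ℕ.* E
      ≡⟨ cong (2 ℕ.*_) (length-filter-cartesianProduct edge? id id) ⟨
    2 ℕ.* numEdges G ∎
    where
    open ≡-Reasoning
    E = sumℕ (λ v → sumℕ (edge v))

-- Sets of bounded spread and the weighted count.

∈-subsets : ∀ {n} (B : Subset n) → B ∈ₗ subsets n
∈-subsets Vec.[]            = here refl
∈-subsets (inside Vec.∷ B)  = ∈-++⁺ˡ (∈-map⁺ _ (∈-subsets B))
∈-subsets (outside Vec.∷ B) = ∈-++⁺ʳ _ (∈-map⁺ _ (∈-subsets B))

max∸min≤ : ∀ {a k n xs} → All (λ x → a ℕ.≤ x × x ℕ.≤ a ℕ.+ k) xs → All (ℕ._≤ n) xs →
           max 0 xs ℕ.∸ min n xs ℕ.≤ k
-- On the empty list the default values leave `0 ∸ n`, which truncates to 0.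
max∸min≤ {n = n} [] [] = ℕ.≤-trans (ℕ.≤-reflexive (ℕ.0∸n≡0 n)) ℕ.z≤n
max∸min≤ {a} {k} {n} {xs} bs@((a≤x , _) ∷ _) (x≤n ∷ _) = begin
  max 0 xs ℕ.∸ min n xs
    ≤⟨ ℕ.∸-mono (max≤v⁺ ℕ.z≤n (All.map proj₂ bs))
                -- The default `n` of `min` must also be at least `a`; the head `x` of the list lies
                -- between the two.
                (v≤min⁺ (ℕ.≤-trans a≤x x≤n) (All.map proj₁ bs)) ⟩
  a ℕ.+ k ℕ.∸ a
    ≡⟨ ℕ.m+n∸m≡n a k ⟩
  k ∎
  where open ℕ.≤-Reasoning

module _ {n : ℕ} (G : Graph n) where

  ∣B∣≤sp : ∀ {k} (B : Subset n) → spread G B ℕ.≤ k → ∣ B ∣ ℕ.≤ sp G k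
  ∣B∣≤sp {k} B sB≤k = v≤max⁺ 0 _ (inj₂ (Any.map ℕ.≤-reflexive
    (∈-map⁺ ∣_∣ (∈-filter⁺ (λ B → spread G B ℕ.≤? k) (∈-subsets B) sB≤k))))

  spread≤ : ∀ {a k} (B : Subset n) → (∀ {v} → v ∈ B → a ℕ.≤ deg G v × deg G v ℕ.≤ a ℕ.+ k) →
            spread G B ℕ.≤ k
  spread≤ B bounds = max∸min≤
    (All.map⁺ (All.map bounds (all-filter (_∈? B) (allFin n))))
    -- A degree is the size of a subset of `Fin n`, so it is at most `n`, the default in
    -- `minDegreeIn`.
    (All.map⁺ (All.universal (λ v → ∣p∣≤n (neighbours G v)) _))

  -- The sum is the size of the set of vertices with degree in `I δ k i`. That interval has
  -- endpoints differing by `k`, so the set competes in the maximum defining `sp G k`.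
  ∑μ≤sp : ∀ δ k i → sumℕ (λ v → μ δ k (deg G v) i) ℕ.≤ sp G k
  ∑μ≤sp δ k i = ℕ.≤-trans (ℕ.≤-reflexive (sym (∣tabulate∣ (does ∘ inI?))))
                          (∣B∣≤sp _ (spread≤ _ (∈-tabulate⁻ inI?)))
    where
    inI? : Decidable (I δ k i ∘ deg G)
    inI? v = I? δ k i (deg G v)

  -- The factor 2 clears the denominator of t(t+1)/2, the total weight, so that the estimate stays
  -- in ℕ.
  2*∑u≤sp : ∀ δ k t → 2 ℕ.* sumℕ (λ v → u δ k t (deg G v)) ℕ.≤ sp G k ℕ.* (t ℕ.* suc t)
  2*∑u≤sp δ k t = begin
    2 ℕ.* sumℕ (λ v → sumℕ (λ i → weight i ℕ.* μᵢ v i))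
      ≡⟨ cong (2 ℕ.*_) (∑-comm (λ v i → weight i ℕ.* μᵢ v i)) ⟩
    2 ℕ.* sumℕ (λ i → sumℕ (λ v → weight i ℕ.* μᵢ v i))
      ≡⟨ cong (2 ℕ.*_) (sum-cong-≗ (λ i → *-distribˡ-sum (weight i) (λ v → μᵢ v i))) ⟨
    2 ℕ.* sumℕ (λ i → weight i ℕ.* sumℕ (λ v → μᵢ v i))
      ≤⟨ ℕ.*-monoʳ-≤ 2 (sum-mono-≤ (λ i → ℕ.*-monoʳ-≤ (weight i) (∑μ≤sp δ k (toℕ i)))) ⟩
    2 ℕ.* sumℕ (λ i → weight i ℕ.* sp G k)
      ≡⟨ cong (2 ℕ.*_) (*-distribʳ-sum (sp G k) weight) ⟨
    2 ℕ.* (sumℕ weight ℕ.* sp G k)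
      ≡⟨ ℕ.*-assoc 2 (sumℕ weight) (sp G k) ⟨
    2 ℕ.* sumℕ weight ℕ.* sp G k
      ≡⟨ cong (ℕ._* sp G k) (2*∑[t∸i] t) ⟩
    t ℕ.* suc t ℕ.* sp G k
      ≡⟨ ℕ.*-comm (t ℕ.* suc t) (sp G k) ⟩
    sp G k ℕ.* (t ℕ.* suc t) ∎
    where
    open ℕ.≤-Reasoning

    weight : Fin t → ℕ
    weight i = t ℕ.∸ toℕ i

    μᵢ : Fin n → Fin t → ℕ
    μᵢ v i = μ δ k (deg G v) (toℕ i)

    2*∑[t∸i] : ∀ t → 2 ℕ.* sumℕ {t} (λ i → t ℕ.∸ toℕ i) ≡ t ℕ.* suc t
    2*∑[t∸i] 0       = refl
    -- The weight at index 0 is `suc t`. The remaining ones, `suc t ∸ suc i`, reduce to the weights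
    -- for `t`.
    2*∑[t∸i] (suc t) = trans (ℕ.*-distribˡ-+ 2 (suc t) (sumℕ {t} (λ i → t ℕ.∸ toℕ i)))
      (trans (cong (2 ℕ.* suc t ℕ.+_) (2*∑[t∸i] t)) (gauss t))
      where
      gauss : ∀ t → 2 ℕ.* suc t ℕ.+ t ℕ.* suc t ≡ suc t ℕ.* suc (suc t)
      gauss = ℕ-Solver.solve-∀

-- Arithmetic in ℤ and ℚ, and the final estimate.

n*c+∑[a-[c-b]] : ∀ {n} (a b : Fin n → ℕ) (c : ℤ) →
  + n * c + (∑[ v < n ] (+ a v - (c - + b v))) ≡ + sumℕ a + + sumℕ b
n*c+∑[a-[c-b]] {0}     a b c = refl
n*c+∑[a-[c-b]] {suc n} a b c = begin
  + suc n * c + ((+ a zero - (c - + b zero)) + S)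
    ≡⟨ cong (_+ ((+ a zero - (c - + b zero)) + S)) (ℤ.suc-* (+ n) c) ⟩
  c + + n * c + ((+ a zero - (c - + b zero)) + S)
    -- The copy of `c` split off from `+ suc n * c` cancels the one subtracted in the term at
    -- `zero`.
    ≡⟨ regroup (+ n * c) c S (+ a zero) (+ b zero) ⟩
  + a zero + + b zero + (+ n * c + S)
    ≡⟨ cong (λ x → + a zero + + b zero + x) (n*c+∑[a-[c-b]] (a ∘ suc) (b ∘ suc) c) ⟩
  + a zero + + b zero + (+ A + + B)
    ≡⟨ interchange (+ a zero) (+ b zero) (+ A) (+ B) ⟩
  + a zero + + A + (+ b zero + + B) ∎
  where
  open ≡-Reasoning
  S = ∑[ v < n ] (+ a (suc v) - (c - + b (suc v)))
  A = sumℕ (a ∘ suc)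
  B = sumℕ (b ∘ suc)

  regroup : ∀ p c s x y → c + p + ((x - (c - y)) + s) ≡ x + y + (p + s)
  regroup = ℤ-Solver.solve-∀

  interchange : ∀ x y p q → x + y + (p + q) ≡ x + p + (y + q)
  interchange = ℤ-Solver.solve-∀

-- Since `_/_` reduces to lowest terms, the comparison is made between unnormalised fractions, where
-- it is cross-multiplication. `mkℚᵘ` stores the denominator minus one.
p≤s*q⇒p/q≤s/1 : ∀ p s q .{{_ : NonZero q}} → p ℤ.≤ s * + q → s / 1 ≥ p / q
p≤s*q⇒p/q≤s/1 p s (suc q) p≤sq = ℚ.toℚᵘ-cancel-≤ (begin
  _              ≃⟨ ℚ.toℚᵘ-fromℚᵘ (ℚᵘ.mkℚᵘ p q) ⟩
  ℚᵘ.mkℚᵘ p q    ≤⟨ ℚᵘ.*≤* (ℤ.≤-trans (ℤ.≤-reflexive (ℤ.*-identityʳ p)) p≤sq) ⟩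
  ℚᵘ.mkℚᵘ s 0    ≃⟨ ℚ.toℚᵘ-fromℚᵘ (ℚᵘ.mkℚᵘ s 0) ⟨
  _              ∎)
  where open ℚᵘ.≤-Reasoning

theorem2 : ∀ {n : ℕ} .{{_ : NonZero n}} (G : Graph n) (k t : ℕ) .{{_ : NonZero t}} →
    let δ = minDegree G
        m = numEdges G
    in
    + (sp G k) / 1
      ≥ _/_ (+ 2 * (+ n * (+ δ + + t * + (suc k)) - + 2 * + m + (∑[ v < n ] ε δ k t (deg G v))))
            (suc k ℕ.* t ℕ.* suc t) {{denominator≢0 k t}}
theorem2 {n} G k t = p≤s*q⇒p/q≤s/1 _ (+ s) (h ℕ.* t ℕ.* suc t) {{denominator≢0 k t}} (begin
  + 2 * (+ n * (+ δ + + t * + h) - + 2 * + m + S)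
    -- This produces the constant δ + th as a single cast natural, the form in which `ε` contains
    -- it.
    ≡⟨ cong (λ c → + 2 * (+ n * (+ δ + c) - + 2 * + m + S)) (sym (ℤ.pos-* t h)) ⟩
  + 2 * (+ n * + (δ ℕ.+ t ℕ.* h) - + 2 * + m + S)
    ≡⟨ cong (+ 2 *_) (move (+ n * + (δ ℕ.+ t ℕ.* h)) (+ 2 * + m) S) ⟩
  + 2 * (+ n * + (δ ℕ.+ t ℕ.* h) + S - + 2 * + m)
    -- Each `ε δ k t (deg G v)` unfolds to a summand of the lemma, with `h ℕ.* u δ k t (deg G v)`
    -- for `a v` and the degree for `b v`.
    ≡⟨ cong (λ x → + 2 * (x - + 2 * + m))
            (n*c+∑[a-[c-b]] (λ v → h ℕ.* u δ k t (deg G v)) (deg G) (+ (δ ℕ.+ t ℕ.* h))) ⟩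
  + 2 * (+ sumℕ (λ v → h ℕ.* u δ k t (deg G v)) + + sumℕ (deg G) - + 2 * + m)
    ≡⟨ cong₂ (λ x y → + 2 * (+ x + y - + 2 * + m))
             (sym (*-distribˡ-sum h (λ v → u δ k t (deg G v))))
             (trans (cong +_ (handshake G)) (ℤ.pos-* 2 m)) ⟩
  + 2 * (+ (h ℕ.* U) + + 2 * + m - + 2 * + m)
    ≡⟨ cong (+ 2 *_) (cancel (+ (h ℕ.* U)) (+ 2 * + m)) ⟩
  + 2 * + (h ℕ.* U)
    ≡⟨ ℤ.pos-* 2 (h ℕ.* U) ⟨
  + (2 ℕ.* (h ℕ.* U))
    ≤⟨ +≤+ bound ⟩
  + (s ℕ.* (h ℕ.* t ℕ.* suc t))
    ≡⟨ ℤ.pos-* s (h ℕ.* t ℕ.* suc t) ⟩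
  + s * + (h ℕ.* t ℕ.* suc t) ∎)
  where
  open ℤ.≤-Reasoning
  δ = minDegree G
  m = numEdges G
  h = suc k
  s = sp G k
  U = sumℕ (λ v → u δ k t (deg G v))
  S = ∑[ v < n ] ε δ k t (deg G v)

  move : ∀ x y z → x - y + z ≡ x + z - y
  move = ℤ-Solver.solve-∀

  cancel : ∀ x y → x + y - y ≡ x
  cancel = ℤ-Solver.solve-∀

  swap : ∀ a b c → a ℕ.* (b ℕ.* c) ≡ b ℕ.* (a ℕ.* c)
  swap = ℕ-Solver.solve-∀

  factor : ∀ h s t → h ℕ.* (s ℕ.* (t ℕ.* suc t)) ≡ s ℕ.* (h ℕ.* t ℕ.* suc t)
  factor = ℕ-Solver.solve-∀

  bound : 2 ℕ.* (h ℕ.* U) ℕ.≤ s ℕ.* (h ℕ.* t ℕ.* suc t)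
  -- The weighted count multiplied by `h`, rearranged to match numerator and denominator.
  bound = subst₂ ℕ._≤_ (swap h 2 U) (factor h s t) (ℕ.*-monoʳ-≤ h (2*∑u≤sp G δ k t))
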